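{- Let $k,t$ be integers with $k\geq 5$ and $k=t$, and let $H$ be a non-empty graph of order $t$ that is not a complete graph. Then $$\operatorname{gr}_k(P_5:H)=t+1 .$$
   Context: All graphs are finite, simple and undirected; a graph is non-empty if it has at least one edge; the order of a graph is its number of vertices. $K_n$ is the complete graph on $n$ vertices and $P_5$ is the path with $5$ vertices and $4$ edges. A $k$-edge-coloring assigns to each edge one of $k$ colors; all $k$-edge-colorings are assumed exact, i.e. each of the $k$ colors is used at least once. An edge-colored graph is rainbow if all its edges have different colors and monochromatic if all its edges have a single color. A copy of a graph means a (not necessarily induced) subgraph isomorphic to it. For non-empty graphs $G,H$ and a positive integer $k$, the Gallai-Ramsey number $\operatorname{gr}_k(G:H)$ is the minimum integer $N$ with $\binom{N}{2}\geq k$ (so that $K_N$ admits a $k$-edge-coloring) such that for all $n\geq N$, every $k$-edge-coloring of $K_n$ contains either a rainbow copy of $G$ or a monochromatic copy of $H$.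
   Formalization: The formal theorem additionally assumes that H has no isolated vertex; without this the claim is false (e.g. H an edge plus t−2 isolated vertices, k=t=5, gives at most t), and it fails for every H with an isolated vertex. -}

module Defs where

open import Data.Nat using (ℕ; suc; _≤_)
open import Data.Nat.Combinatorics using (_C_)
import Data.Nat.Properties as ℕ
open import Data.Fin using (Fin; toℕ; _≟_)
open import Data.Product using (_×_; ∃; ∃-syntax)
open import Data.Sum using (_⊎_; swap; [_,_]′)
open import Function using (Injective)
open import Level using (0ℓ)
open import Relation.Binary using (Rel; Symmetric; Irreflexive; Decidable)
open import Relation.Binary.PropositionalEquality
  using (_≡_; _≢_; refl; ≢-sym)
open import Relation.Nullary using (¬_; ¬?; _⊎-dec_)

-- Finite simple graphs of order n; adjacency is decidable, as it is for
-- any finite graph in classical mathematics.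
record Graph (n : ℕ) : Set₁ where
  infix 4 _~_ _~?_
  field
    _~_      : Rel (Fin n) 0ℓ
    _~?_     : Decidable _~_
    ~-sym    : Symmetric _~_
    ~-irrefl : Irreflexive _≡_ _~_

NonEmpty : ∀ {n} → Graph n → Set
NonEmpty G = ∃[ u ] ∃[ v ] u ~ v
  where open Graph G

Complete : ∀ {n} → Graph n → Set
Complete G = ∀ u v → u ≢ v → u ~ v
  where open Graph G

-- Needed because isolated vertices of H may be mapped to vertices that meet
-- no edge of the color: K n, n ≥ 5, always has a monochromatic copy of an
-- edge plus three isolated vertices.
NoIsolatedVertex : ∀ {n} → Graph n → Set
NoIsolatedVertex G = ∀ u → ∃[ v ] u ~ v
  where open Graph G

K : ∀ n → Graph n
K n = record
  { _~_      = _≢_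
  ; _~?_     = λ u v → ¬? (u ≟ v)
  ; ~-sym    = ≢-sym
  ; ~-irrefl = λ u≡v u≢v → u≢v u≡v
  }

-- The path with n vertices (hence n ∸ 1 edges).
P : ∀ n → Graph n
P n = record
  { _~_      = λ u v → suc (toℕ u) ≡ toℕ v ⊎ suc (toℕ v) ≡ toℕ u
  ; _~?_     = λ u v → (suc (toℕ u) ℕ.≟ toℕ v) ⊎-dec (suc (toℕ v) ℕ.≟ toℕ u)
  ; ~-sym    = swap
  ; ~-irrefl = λ { refl → [ ℕ.1+n≢n , ℕ.1+n≢n ]′ }
  }

-- A copy of G in F, given by an isomorphism from G onto a (not necessarily
-- induced) subgraph of F.
record Copy {m n} (G : Graph m) (F : Graph n) : Set where
  open Graph
  field
    map       : Fin m → Fin n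
    injective : Injective _≡_ _≡_ map
    preserves : ∀ {u v} → _~_ G u v → _~_ F (map u) (map v)

-- Edge-colorings of K n with colors in Fin k.  An edge is an unordered pair
-- of distinct vertices, whence the symmetry; the values colour u u carry no
-- meaning, and nothing below refers to them.
record Coloring (k n : ℕ) : Set where
  field
    colour     : Fin n → Fin n → Fin k
    colour-sym : ∀ u v → colour u v ≡ colour v u

Exact : ∀ {k n} → Coloring k n → Set
Exact {k} χ = ∀ (c : Fin k) → ∃[ u ] ∃[ v ] u ≢ v × colour u v ≡ c
  where open Coloring χ

module _ {k n m : ℕ} (χ : Coloring k n) {G : Graph m} (copy : Copy G (K n)) where
  open Coloring χ
  open Graph G
  open Copy copy

  -- The conclusion says that {u , v} and {x , y} are the same edge.
  Rainbow : Set
  Rainbow = ∀ {u v x y} → u ~ v → x ~ y →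
            colour (map u) (map v) ≡ colour (map x) (map y) →
            (u ≡ x × v ≡ y) ⊎ (u ≡ y × v ≡ x)

  Monochromatic : Set
  Monochromatic = ∃[ c ] (∀ {u v} → u ~ v → colour (map u) (map v) ≡ c)

Forces : ∀ {m t} → ℕ → Graph m → Graph t → ℕ → Set
Forces k G H N =
  k ≤ N C 2 ×
  (∀ n → N ≤ n → (χ : Coloring k n) → Exact χ →
     (∃ λ (copy : Copy G (K n)) → Rainbow χ copy) ⊎
     (∃ λ (copy : Copy H (K n)) → Monochromatic χ copy))

-- gr[ k ] G ∶ H ≈ N says that the Gallai–Ramsey number gr_k(G : H) is N.
infix 4 gr[_]_∶_≈_
gr[_]_∶_≈_ : ∀ {m t} → ℕ → Graph m → Graph t → ℕ → Set
gr[ k ] G ∶ H ≈ N = Forces k G H N × (∀ M → Forces k G H M → N ≤ M)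

{-# OPTIONS --safe #-}

-- Lower bound: colour K t by a rainbow star and one further colour on the
-- remaining vertices.  Each star colour is used once and the further colour
-- misses the centre, so neither contains a spanning H without isolated vertices.
--
-- Upper bound: suppose that there is no rainbow P 5.  If some vertex a sees at
-- least three colours, then all edges off a have the same colour, and H fits
-- there.  Otherwise every vertex sees at most two colours; the sets of colours
-- seen by two vertices meet in the colour of their edge, and as there are more
-- than three colours, they all contain one colour α.  Choose an edge of some
-- colour other than α and one end of an edge of every remaining colour: all edges
-- between these k vertices but the chosen one have colour α, and H lacks an edge.
module Submission where

open import Defs
open import Data.Bool using (true; false; if_then_else_)
open import Data.Empty using (⊥; ⊥-elim)
open import Data.Fin using (Fin; zero; suc; toℕ; _≟_; _≤?_; inject₁; inject≤; punchIn)
open import Data.Fin.Patterns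
open import Data.Fin.Permutation.Components using (transpose; transpose-inverse)
open import Data.Fin.Properties
  using (any?; all?; pigeonhole; ¬∀⟶∃¬; <⇒≢; toℕ-injective; toℕ-inject₁;
         inject≤-injective; punchIn-injective; punchInᵢ≢i)
open import Data.List as List using (List; []; _∷_; _++_; map; length)
import Data.List.Membership.DecPropositional as DecMembership
open import Data.List.Membership.Propositional using (_∈_)
open import Data.List.Membership.Propositional.Properties using (∈-lookup)
open import Data.List.Membership.Setoid.Properties using (index-injective)
open import Data.List.Relation.Unary.All as All using (All; []; _∷_)
import Data.List.Relation.Unary.All.Properties as All
open import Data.List.Relation.Unary.AllPairs using ([]; _∷_)
open import Data.List.Relation.Unary.Any using (index)
open import Data.List.Relation.Unary.Unique.DecPropositional using (unique?)
open import Data.List.Relation.Unary.Unique.Propositional using (Unique)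
open import Data.Maybe as Maybe using (Maybe; just; nothing; zipWith; _<∣>_; from-just)
open import Data.Nat using (ℕ; zero; suc; _+_; _≤_; _<_; _≥_; z≤n; s≤s)
open import Data.Nat.Combinatorics using (_C_; nC1≡n; nCk+nC[k+1]≡[n+1]C[k+1])
open import Data.Nat.Properties as ℕ using (≤-trans; m≤m+n)
open import Data.Product using (_×_; _,_; ∃; ∃-syntax; proj₁; proj₂)
open import Data.Product.Properties using (≡-dec)
open import Data.Sum using (_⊎_; inj₁; inj₂)
open import Data.Vec using (Vec; []; _∷_; lookup)
open import Function using (_∘_; Injective)
open import Relation.Binary using (DecidableEquality)
open import Relation.Binary.PropositionalEquality
  using (_≡_; _≢_; refl; sym; trans; cong; subst; ≢-sym; setoid)
open import Relation.Nullary using (¬_; Dec; yes; no; does; ¬?; _×-dec_)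
open import Relation.Nullary.Decidable using (decidable-stable; dec-true)

-- Refuting systems of equalities and inequalities of colours

pairs : {A : Set} → List A → List (A × A)
pairs []       = []
pairs (x ∷ xs) = map (x ,_) xs ++ pairs xs

Differ : {A B : Set} → (A → B) → A × A → Set
Differ ρ (x , y) = ρ x ≢ ρ y

pairs-unique : {A B : Set} {ρ : A → B} (xs : List A) →
               All (Differ ρ) (pairs xs) → Unique (map ρ xs)
pairs-unique []       _  = []
pairs-unique (x ∷ xs) ds with ds₁ , ds₂ ← All.++⁻ (map (x ,_) xs) ds =
  All.map⁺ (All.map⁻ ds₁) ∷ pairs-unique xs ds₂

-- A certified search for contradictions between equalities and inequalities of
-- the values ρ x.  It branches on the equalities x ≡ y of a clause, recording
-- them in a substitution σ; nothing means that no contradiction was found.  The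
-- search only inspects A, so from-just computes even when ρ is a variable.
module Refutation {A : Set} (_≟ᴬ_ : DecidableEquality A) {B : Set} (ρ : A → B) where

  -- A disjunction of equalities in negated form: every goal is a contradiction, so no disjunct ever
  -- has to be chosen.
  Clause : List (A × A) → Set
  Clause c = ¬ All (Differ ρ) c

  Sound : (A → A) → Set
  Sound σ = ∀ x → ρ (σ x) ≡ ρ x

  identify : A → A → A → A
  identify x y z = if does (z ≟ᴬ x) then y else z

  identify-sound : ∀ {x y} → ρ x ≡ ρ y → Sound (identify x y)
  identify-sound {x} eq z with z ≟ᴬ x
  ... | yes refl = sym eq
  ... | no  _    = refl

  -- Serves twice: on the known inequalities a hit is a contradiction, on a clause it shows that the
  -- clause already holds.
  clash : ∀ σ ds → Maybe (Sound σ → Clause ds)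
  clash σ []             = nothing
  clash σ ((x , y) ∷ ds) with σ x ≟ᴬ σ y
  ... | yes eq = just λ { s (d ∷ _) → d (trans (sym (s x)) (trans (cong ρ eq) (s y))) }
  ... | no  _  = Maybe.map (λ { r s (_ ∷ ds) → r s ds }) (clash σ ds)

  module _ (ds : List (A × A)) where

    Contradicts : (A → A) → List (List (A × A)) → Set
    Contradicts σ cs = Sound σ → All (Differ ρ) ds → All Clause cs → ⊥

    search   : ∀ σ cs → Maybe (Contradicts σ cs)
    search′  : ∀ σ cs → Maybe (Contradicts σ cs)
    -- Refuting each equality of `c` in turn proves all the inequalities that the clause `c` denies.
    branches : ∀ σ c cs →
               Maybe (Sound σ → All (Differ ρ) ds → All Clause cs → All (Differ ρ) c)

    search σ cs with clash σ ds
    ... | just r  = just λ s d _ → r s d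
    ... | nothing = search′ σ cs

    -- If σ identifies the two sides of a literal of c, then c carries no information.
    search′ σ []       = nothing
    search′ σ (c ∷ cs) with clash σ c
    ... | just _  = Maybe.map (λ { r s d (_ ∷ p) → r s d p }) (search′ σ cs)
    ... | nothing = Maybe.map (λ { r s d (q ∷ p) → q (r s d p) }) (branches σ c cs)

    branches σ []            cs = just λ _ _ _ → []
    branches σ ((x , y) ∷ c) cs = zipWith
      (λ r rs s d p →
        (λ eq → r (λ z → trans
                      (identify-sound (trans (s x) (trans eq (sym (s y)))) (σ z)) (s z))
                  d p)
        ∷ rs s d p)
      (search (identify (σ x) (σ y) ∘ σ) cs) (branches σ c cs)

-- Colourings without a rainbow path, as input for the refutation

NoRainbow : ∀ {k n} → Coloring k n → Set
NoRainbow {n = n} χ = ∀ (a b c d e : Fin n) → Unique (a ∷ b ∷ c ∷ d ∷ e ∷ []) →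
  ¬ Unique (colour a b ∷ colour b c ∷ colour c d ∷ colour d e ∷ [])
  where open Coloring χ

infix 4 _─_─_─_─_
data Path (m : ℕ) : Set where
  _─_─_─_─_ : (a b c d e : Fin m) → Path m

Edge : ℕ → Set
Edge m = Fin m × Fin m

infix 4 _≟ᴱ_
_≟ᴱ_ : ∀ {m} → DecidableEquality (Edge m)
_≟ᴱ_ = ≡-dec _≟_ _≟_

-- A normal form of unordered edges. As the initial substitution it builds the symmetry of `colour`
-- into the search.
orient : ∀ {m} → Edge m → Edge m
orient (i , j) = if does (i ≤? j) then (i , j) else (j , i)

vertices : ∀ {m} → Path m → List (Fin m)
vertices (a ─ b ─ c ─ d ─ e) = a ∷ b ∷ c ∷ d ∷ e ∷ []

edges : ∀ {m} → Path m → List (Edge m)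
edges (a ─ b ─ c ─ d ─ e) = (a , b) ∷ (b , c) ∷ (c , d) ∷ (d , e) ∷ []

-- Entries of `vs` may coincide; a path counts only if its vertices are provably distinct.
module Local {k n} (χ : Coloring k n) (noRainbow : NoRainbow χ)
             {m} (vs : Vec (Fin n) m) where
  open Coloring χ

  v : Fin m → Fin n
  v = lookup vs

  ρ : Edge m → Fin k
  ρ (i , j) = colour (v i) (v j)

  open Refutation _≟ᴱ_ ρ

  orient-sound : Sound orient
  orient-sound (i , j) with does (i ≤? j)
  ... | true  = refl
  ... | false = colour-sym (v j) (v i)

  module _ (ns : List (Fin m × Fin m)) (ds : List (Edge m × Edge m)) where

    apartᵛ : ∀ i j ns → Maybe (All (Differ v) ns → v i ≢ v j)
    apartᵛ i j []              = nothing
    apartᵛ i j ((i′ , j′) ∷ ns) with i ≟ i′ | j ≟ j′ | i ≟ j′ | j ≟ i′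
    ... | yes refl | yes refl | _        | _        = just λ { (p ∷ _) → p }
    ... | _        | _        | yes refl | yes refl = just λ { (p ∷ _) → ≢-sym p }
    ... | _        | _        | _        | _        =
      Maybe.map (λ { r (_ ∷ ps) → r ps }) (apartᵛ i j ns)

    -- Edges of different colours from v a to v i and to v j show that v i ≢ v j.
    apartᵉ : ∀ i j ds → Maybe (All (Differ ρ) ds → v i ≢ v j)
    apartᵉ i j [] = nothing
    apartᵉ i j (((a , i′) , (a′ , j′)) ∷ ds) with a ≟ a′ | i ≟ i′ | j ≟ j′ | i ≟ j′ | j ≟ i′
    ... | yes refl | yes refl | yes refl | _ | _ = just λ { (p ∷ _) → p ∘ cong (colour (v a)) }
    ... | yes refl | _ | _ | yes refl | yes refl = just λ { (p ∷ _) → p ∘ cong (colour (v a)) ∘ sym }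
    ... | _ | _ | _ | _ | _ = Maybe.map (λ { r (_ ∷ ps) → r ps }) (apartᵉ i j ds)

    Apart : Set
    Apart = All (Differ v) ns × All (Differ ρ) ds

    apart : ∀ i j → Maybe (Apart → v i ≢ v j)
    apart i j = Maybe.map (_∘ proj₁) (apartᵛ i j ns) <∣> Maybe.map (_∘ proj₂) (apartᵉ i j ds)

    distinct : ∀ es → Maybe (Apart → All (Differ v) es)
    distinct []             = just λ _ → []
    distinct ((i , j) ∷ es) = zipWith (λ r rs p → r p ∷ rs p) (apart i j) (distinct es)

    -- Two of the four colours on a path agree, which is one clause of six equalities.
    pathClauses : ∀ ps → Maybe (Apart → All Clause (map (pairs ∘ edges) ps))
    pathClauses []       = just λ _ → []
    pathClauses (P@(a ─ b ─ c ─ d ─ e) ∷ ps) = zipWith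
      (λ r rs p →
        (λ ds → noRainbow (v a) (v b) (v c) (v d) (v e)
                  (pairs-unique (vertices P) (r p)) (pairs-unique (edges P) ds))
        ∷ rs p)
      (distinct (pairs (vertices P))) (pathClauses ps)

    -- For pairs ns of distinct vertices, pairs ds of edges of different colours and
    -- clauses cs, it suffices to name the paths ps whose repeated colours to use.
    refutation : ∀ cs ps →
      Maybe (All (Differ v) ns → All (Differ ρ) ds → All Clause cs → ⊥)
    refutation cs ps = zipWith
      (λ r s p q t → s orient-sound q (All.++⁺ t (r (p , q))))
      (pathClauses ps) (search ds orient (cs ++ map (pairs ∘ edges) ps))

-- Fresh elements and the colours seen by a vertex

-- Otherwise positions in `xs` would inject `Fin n` into a smaller set.
fresh : ∀ {n} (xs : List (Fin n)) → length xs < n → ∃ λ i → All (i ≢_) xs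
fresh {n} xs ∣xs∣<n with any? (λ i → ¬? (i ∈? xs))
  where open DecMembership _≟_ using (_∈?_)
... | yes (i , i∉xs) = i , All.¬Any⇒All¬ xs i∉xs
... | no  none       =
  let i , j , i<j , eq = pigeonhole ∣xs∣<n (λ i → index (covered i))
  in  ⊥-elim (<⇒≢ i<j (index-injective (setoid _) (covered i) (covered j) eq))
  where
  open DecMembership _≟_ using (_∈?_)
  covered : ∀ i → i ∈ xs
  covered i = decidable-stable (i ∈? xs) (λ i∉xs → none (i , i∉xs))

module Palette {k n} (χ : Coloring k n) where
  open Coloring χ

  Seen : Fin n → Fin k → Set
  Seen a c = ∃ λ z → a ≢ z × colour a z ≡ c

  seen? : ∀ a c → Dec (Seen a c)
  seen? a c = any? λ z → ¬? (a ≟ z) ×-dec (colour a z ≟ c)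

  Pick : Fin n → List (Fin k) → Set
  Pick a cs = ∃ λ z → a ≢ z × All (colour a z ≢_) cs

  pick? : ∀ a cs → Dec (Pick a cs)
  pick? a cs = any? λ z → ¬? (a ≟ z) ×-dec All.all? (λ c → ¬? (colour a z ≟ c)) cs

  -- a sees at least three colours
  Rich : Fin n → Set
  Rich a = ∀ c₁ c₂ → Pick a (c₁ ∷ c₂ ∷ [])

  rich? : ∀ a → Dec (Rich a)
  rich? a = all? λ c₁ → all? λ c₂ → pick? a (c₁ ∷ c₂ ∷ [])

  Poor : Fin n → Set
  Poor a = ∃[ c₁ ] ∃[ c₂ ] ∀ z → a ≢ z → colour a z ≡ c₁ ⊎ colour a z ≡ c₂

  ¬rich⇒poor : ∀ {a} → ¬ Rich a → Poor a
  ¬rich⇒poor {a} ¬rich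
    with c₁ , ¬rich₁ ← ¬∀⟶∃¬ k _ (λ c₁ → all? λ c₂ → pick? a (c₁ ∷ c₂ ∷ [])) ¬rich
    with c₂ , ¬pick ← ¬∀⟶∃¬ k _ (λ c₂ → pick? a (c₁ ∷ c₂ ∷ [])) ¬rich₁ = c₁ , c₂ , two
    where
    two : ∀ z → a ≢ z → colour a z ≡ c₁ ⊎ colour a z ≡ c₂
    two z a≢z with colour a z ≟ c₁ | colour a z ≟ c₂
    ... | yes eq | _      = inj₁ eq
    ... | no _   | yes eq = inj₂ eq
    ... | no ≢c₁ | no ≢c₂ = ⊥-elim (¬pick (z , a≢z , ≢c₁ ∷ ≢c₂ ∷ []))

  flip : ∀ {x y c} → colour x y ≡ c → colour y x ≡ c
  flip {x} {y} = trans (colour-sym y x)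

  sees : ∀ {u v} → u ≢ v → Seen u (colour u v)
  sees {v = v} u≢v = v , u≢v , refl

  seesʳ : ∀ {u v} → u ≢ v → Seen v (colour u v)
  seesʳ {u} {v} u≢v = u , ≢-sym u≢v , colour-sym v u

-- A vertex that sees at least three colours

pattern 𝕒 = 0F
pattern 𝕩 = 1F
pattern 𝕪 = 2F
pattern 𝕨 = 3F
pattern 𝕫 = 4F
pattern 𝕦 = 5F
pattern 𝕧 = 6F

module RainbowFree {k n} (χ : Coloring k n) (noRainbow : NoRainbow χ)
                   (4<k : 4 < k) (4<n : 4 < n) where
  open Coloring χ
  open Local χ noRainbow
  open Palette χ

  -- If a sees a colour outside any set of four colours containing the colours p
  -- and q of two adjacent edges off a, then p ≡ q.  Write f for the colour of the
  -- edge to a.  If two vertices other than x, y, w have different colours f outside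
  -- {p , q , f y}, then f x and f w lie in {p , q}; otherwise p, q, f x, f y, f w are
  -- distinct.  Both configurations force a rainbow P 5.
  module Fork {a x y w : Fin n} (a≢x : a ≢ x) (a≢y : a ≢ y) (a≢w : a ≢ w)
              (x≢y : x ≢ y) (x≢w : x ≢ w) (y≢w : y ≢ w)
              (p≢q : colour x y ≢ colour y w) where

    p q : Fin k
    p = colour x y
    q = colour y w

    Avoids : Fin n → List (Fin k) → Set
    Avoids z cs = a ≢ z × All (colour a z ≢_) (p ∷ q ∷ cs)

    -- Otherwise z ─ a ─ x ─ y ─ w is rainbow; `right` is the mirror image.
    left : ∀ {z} → a ≢ z → y ≢ z → w ≢ z → All (colour a z ≢_) (p ∷ q ∷ colour a x ∷ []) →
           ¬ All (colour a x ≢_) (p ∷ q ∷ [])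
    left {z} a≢z y≢z w≢z (z₁ ∷ z₂ ∷ z₃ ∷ []) (x₁ ∷ x₂ ∷ []) =
      from-just (refutation (a ∷ x ∷ y ∷ w ∷ z ∷ [])
        ((𝕒 , 𝕩) ∷ (𝕒 , 𝕪) ∷ (𝕒 , 𝕨) ∷ (𝕒 , 𝕫) ∷ (𝕩 , 𝕪) ∷ (𝕩 , 𝕨) ∷ (𝕪 , 𝕨) ∷
         (𝕪 , 𝕫) ∷ (𝕨 , 𝕫) ∷ [])
        (((𝕩 , 𝕪) , (𝕪 , 𝕨)) ∷
         ((𝕒 , 𝕫) , (𝕩 , 𝕪)) ∷ ((𝕒 , 𝕫) , (𝕪 , 𝕨)) ∷ ((𝕒 , 𝕫) , (𝕒 , 𝕩)) ∷
         ((𝕒 , 𝕩) , (𝕩 , 𝕪)) ∷ ((𝕒 , 𝕩) , (𝕪 , 𝕨)) ∷ [])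
        []
        ((𝕫 ─ 𝕒 ─ 𝕩 ─ 𝕪 ─ 𝕨) ∷ []))
        (a≢x ∷ a≢y ∷ a≢w ∷ a≢z ∷ x≢y ∷ x≢w ∷ y≢w ∷ y≢z ∷ w≢z ∷ [])
        (p≢q ∷ z₁ ∷ z₂ ∷ z₃ ∷ x₁ ∷ x₂ ∷ []) []

    right : ∀ {z} → a ≢ z → y ≢ z → x ≢ z → All (colour a z ≢_) (p ∷ q ∷ colour a w ∷ []) →
            ¬ All (colour a w ≢_) (p ∷ q ∷ [])
    right {z} a≢z y≢z x≢z (z₁ ∷ z₂ ∷ z₃ ∷ []) (w₁ ∷ w₂ ∷ []) =
      from-just (refutation (a ∷ x ∷ y ∷ w ∷ z ∷ [])
        ((𝕒 , 𝕩) ∷ (𝕒 , 𝕪) ∷ (𝕒 , 𝕨) ∷ (𝕒 , 𝕫) ∷ (𝕩 , 𝕪) ∷ (𝕩 , 𝕨) ∷ (𝕪 , 𝕨) ∷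
         (𝕪 , 𝕫) ∷ (𝕩 , 𝕫) ∷ [])
        (((𝕩 , 𝕪) , (𝕪 , 𝕨)) ∷
         ((𝕒 , 𝕫) , (𝕩 , 𝕪)) ∷ ((𝕒 , 𝕫) , (𝕪 , 𝕨)) ∷ ((𝕒 , 𝕫) , (𝕒 , 𝕨)) ∷
         ((𝕒 , 𝕨) , (𝕩 , 𝕪)) ∷ ((𝕒 , 𝕨) , (𝕪 , 𝕨)) ∷ [])
        []
        ((𝕫 ─ 𝕒 ─ 𝕨 ─ 𝕪 ─ 𝕩) ∷ []))
        (a≢x ∷ a≢y ∷ a≢w ∷ a≢z ∷ x≢y ∷ x≢w ∷ y≢w ∷ y≢z ∷ x≢z ∷ [])
        (p≢q ∷ z₁ ∷ z₂ ∷ z₃ ∷ w₁ ∷ w₂ ∷ []) []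

    -- `fx` and `fw` leave only `p` and `q` for the edges from `a` to `x` and `w`; the search splits
    -- on these two clauses first.
    endsInside : ∀ {z u} → Avoids z (colour a y ∷ []) → Avoids u (colour a y ∷ colour a z ∷ []) →
                 x ≢ z → w ≢ z → x ≢ u → w ≢ u →
                 ¬ All (colour a x ≢_) (p ∷ q ∷ []) → ¬ All (colour a w ≢_) (p ∷ q ∷ []) → ⊥
    endsInside {z} {u} (a≢z , z₁ ∷ z₂ ∷ z₃ ∷ []) (a≢u , u₁ ∷ u₂ ∷ u₃ ∷ u₄ ∷ [])
               x≢z w≢z x≢u w≢u fx fw =
      from-just (refutation (a ∷ x ∷ y ∷ w ∷ z ∷ u ∷ [])
        ((𝕒 , 𝕩) ∷ (𝕒 , 𝕪) ∷ (𝕒 , 𝕨) ∷ (𝕒 , 𝕫) ∷ (𝕒 , 𝕦) ∷ (𝕩 , 𝕪) ∷ (𝕩 , 𝕨) ∷ (𝕪 , 𝕨) ∷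
         (𝕩 , 𝕫) ∷ (𝕨 , 𝕫) ∷ (𝕩 , 𝕦) ∷ (𝕨 , 𝕦) ∷ [])
        (((𝕩 , 𝕪) , (𝕪 , 𝕨)) ∷
         ((𝕒 , 𝕫) , (𝕩 , 𝕪)) ∷ ((𝕒 , 𝕫) , (𝕪 , 𝕨)) ∷ ((𝕒 , 𝕫) , (𝕒 , 𝕪)) ∷
         ((𝕒 , 𝕦) , (𝕩 , 𝕪)) ∷ ((𝕒 , 𝕦) , (𝕪 , 𝕨)) ∷ ((𝕒 , 𝕦) , (𝕒 , 𝕪)) ∷ ((𝕒 , 𝕦) , (𝕒 , 𝕫)) ∷ [])
        ((((𝕒 , 𝕩) , (𝕩 , 𝕪)) ∷ ((𝕒 , 𝕩) , (𝕪 , 𝕨)) ∷ []) ∷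
         (((𝕒 , 𝕨) , (𝕩 , 𝕪)) ∷ ((𝕒 , 𝕨) , (𝕪 , 𝕨)) ∷ []) ∷ [])
        -- found by computer search, like the order in which they are used
        ((𝕪 ─ 𝕩 ─ 𝕫 ─ 𝕒 ─ 𝕦) ∷ (𝕒 ─ 𝕫 ─ 𝕩 ─ 𝕪 ─ 𝕨) ∷ (𝕫 ─ 𝕩 ─ 𝕪 ─ 𝕒 ─ 𝕦) ∷ (𝕒 ─ 𝕩 ─ 𝕫 ─ 𝕪 ─ 𝕨) ∷
         (𝕫 ─ 𝕪 ─ 𝕨 ─ 𝕒 ─ 𝕦) ∷ (𝕩 ─ 𝕪 ─ 𝕫 ─ 𝕒 ─ 𝕦) ∷ (𝕨 ─ 𝕪 ─ 𝕫 ─ 𝕒 ─ 𝕦) ∷ (𝕩 ─ 𝕫 ─ 𝕪 ─ 𝕒 ─ 𝕦) ∷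
         (𝕒 ─ 𝕫 ─ 𝕩 ─ 𝕨 ─ 𝕪) ∷ (𝕨 ─ 𝕩 ─ 𝕫 ─ 𝕒 ─ 𝕦) ∷ (𝕒 ─ 𝕫 ─ 𝕪 ─ 𝕨 ─ 𝕩) ∷ (𝕫 ─ 𝕩 ─ 𝕨 ─ 𝕒 ─ 𝕦) ∷
         (𝕩 ─ 𝕨 ─ 𝕪 ─ 𝕒 ─ 𝕦) ∷ (𝕒 ─ 𝕪 ─ 𝕨 ─ 𝕩 ─ 𝕫) ∷ (𝕒 ─ 𝕪 ─ 𝕫 ─ 𝕩 ─ 𝕨) ∷ (𝕪 ─ 𝕨 ─ 𝕫 ─ 𝕒 ─ 𝕦) ∷
         (𝕨 ─ 𝕫 ─ 𝕪 ─ 𝕒 ─ 𝕦) ∷ (𝕫 ─ 𝕨 ─ 𝕪 ─ 𝕒 ─ 𝕦) ∷ (𝕒 ─ 𝕨 ─ 𝕫 ─ 𝕪 ─ 𝕩) ∷ []))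
        (a≢x ∷ a≢y ∷ a≢w ∷ a≢z ∷ a≢u ∷ x≢y ∷ x≢w ∷ y≢w ∷ x≢z ∷ w≢z ∷ x≢u ∷ w≢u ∷ [])
        (p≢q ∷ z₁ ∷ z₂ ∷ z₃ ∷ u₁ ∷ u₂ ∷ u₃ ∷ u₄ ∷ [])
        ((λ { (x₁ ∷ x₂ ∷ []) → fx (x₁ ∷ x₂ ∷ []) }) ∷
         (λ { (w₁ ∷ w₂ ∷ []) → fw (w₁ ∷ w₂ ∷ []) }) ∷ [])

    -- The paths a ─ x ─ y ─ w ─ s and x ─ y ─ a ─ w ─ s leave only the colour `p` for the edge w s,
    -- and x ─ a ─ y ─ w ─ s excludes it. In the search, `𝕫` stands for `s`.
    endsOutside : ∀ {s} → a ≢ s → x ≢ s → y ≢ s → w ≢ s →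
      All (colour a x ≢_) (p ∷ q ∷ colour a w ∷ colour a y ∷ []) →
      All (colour a w ≢_) (p ∷ q ∷ colour a y ∷ []) →
      All (colour a y ≢_) (p ∷ q ∷ []) → ⊥
    endsOutside {s} a≢s x≢s y≢s w≢s
                (x₁ ∷ x₂ ∷ x₃ ∷ x₄ ∷ []) (w₁ ∷ w₂ ∷ w₃ ∷ []) (y₁ ∷ y₂ ∷ []) =
      from-just (refutation (a ∷ x ∷ y ∷ w ∷ s ∷ [])
        ((𝕒 , 𝕩) ∷ (𝕒 , 𝕪) ∷ (𝕒 , 𝕨) ∷ (𝕩 , 𝕪) ∷ (𝕩 , 𝕨) ∷ (𝕪 , 𝕨) ∷
         (𝕒 , 𝕫) ∷ (𝕩 , 𝕫) ∷ (𝕪 , 𝕫) ∷ (𝕨 , 𝕫) ∷ [])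
        (((𝕩 , 𝕪) , (𝕪 , 𝕨)) ∷
         ((𝕒 , 𝕩) , (𝕩 , 𝕪)) ∷ ((𝕒 , 𝕩) , (𝕪 , 𝕨)) ∷ ((𝕒 , 𝕩) , (𝕒 , 𝕨)) ∷ ((𝕒 , 𝕩) , (𝕒 , 𝕪)) ∷
         ((𝕒 , 𝕨) , (𝕩 , 𝕪)) ∷ ((𝕒 , 𝕨) , (𝕪 , 𝕨)) ∷ ((𝕒 , 𝕨) , (𝕒 , 𝕪)) ∷
         ((𝕒 , 𝕪) , (𝕩 , 𝕪)) ∷ ((𝕒 , 𝕪) , (𝕪 , 𝕨)) ∷ [])
        []
        ((𝕒 ─ 𝕩 ─ 𝕪 ─ 𝕨 ─ 𝕫) ∷ (𝕩 ─ 𝕪 ─ 𝕒 ─ 𝕨 ─ 𝕫) ∷ (𝕩 ─ 𝕒 ─ 𝕪 ─ 𝕨 ─ 𝕫) ∷ []))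
        (a≢x ∷ a≢y ∷ a≢w ∷ x≢y ∷ x≢w ∷ y≢w ∷ a≢s ∷ x≢s ∷ y≢s ∷ w≢s ∷ [])
        (p≢q ∷ x₁ ∷ x₂ ∷ x₃ ∷ x₄ ∷ w₁ ∷ w₂ ∷ w₃ ∷ y₁ ∷ y₂ ∷ []) []

    impossible : (∀ c₁ c₂ → ∃ λ z → Avoids z (c₁ ∷ c₂ ∷ [])) → ⊥
    impossible pick
      -- The avoided colours keep `z` away from `x` and `y`, so that `left` applies unless `z` is
      -- `w`; symmetrically for `z′` and `right`.
      with z , a≢z , z₁ ∷ z₂ ∷ z₃ ∷ z₄ ∷ [] ← pick (colour a x) (colour a y)
         | z′ , a≢z′ , z₁′ ∷ z₂′ ∷ z₃′ ∷ z₄′ ∷ [] ← pick (colour a w) (colour a y)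
      with w ≟ z | x ≟ z′
    ... | no w≢z | no x≢z′
      with u , a≢u , u₁ ∷ u₂ ∷ u₃ ∷ u₄ ∷ [] ← pick (colour a y) (colour a z) =
      endsInside (a≢z , z₁ ∷ z₂ ∷ z₄ ∷ []) (a≢u , u₁ ∷ u₂ ∷ u₃ ∷ u₄ ∷ [])
        (λ { refl → z₃ refl }) w≢z
        (λ { refl → x∈pq (u₁ ∷ u₂ ∷ []) }) (λ { refl → w∈pq (u₁ ∷ u₂ ∷ []) })
        x∈pq w∈pq
      where
      x∈pq = left a≢z (λ { refl → z₄ refl }) w≢z (z₁ ∷ z₂ ∷ z₃ ∷ [])
      w∈pq = right a≢z′ (λ { refl → z₄′ refl }) x≢z′ (z₁′ ∷ z₂′ ∷ z₃′ ∷ [])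
    ... | no w≢z | yes refl =
      left a≢z (λ { refl → z₄ refl }) w≢z (z₁ ∷ z₂ ∷ z₃ ∷ []) (z₁′ ∷ z₂′ ∷ [])
    ... | yes refl | no x≢z′ =
      right a≢z′ (λ { refl → z₄′ refl }) x≢z′ (z₁′ ∷ z₂′ ∷ z₃′ ∷ []) (z₁ ∷ z₂ ∷ [])
    -- Both end colours now lie outside `p` and `q`. By `left`, a further colour can only be found
    -- at `y`.
    ... | yes refl | yes refl
      with u , a≢u , u₁ ∷ u₂ ∷ u₃ ∷ u₄ ∷ [] ← pick (colour a x) (colour a w)
      with y ≟ u
    ...   | no y≢u   = left a≢u y≢u (λ { refl → u₄ refl }) (u₁ ∷ u₂ ∷ u₃ ∷ []) (z₁′ ∷ z₂′ ∷ [])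
    ...   | yes refl
      with s , s≢a ∷ s≢x ∷ s≢y ∷ s≢w ∷ [] ← fresh (a ∷ x ∷ y ∷ w ∷ []) 4<n =
      endsOutside (≢-sym s≢a) (≢-sym s≢x) (≢-sym s≢y) (≢-sym s≢w)
        (z₁′ ∷ z₂′ ∷ z₃′ ∷ z₄′ ∷ []) (z₁ ∷ z₂ ∷ z₄ ∷ []) (u₁ ∷ u₂ ∷ [])

  off : ∀ {a x y c} → ¬ Seen a c → x ≢ y → colour x y ≡ c → a ≢ x
  off {y = y} unseen x≢y xy≡c refl = unseen (y , x≢y , xy≡c)

  module TwoMissing {a : Fin n} {p q : Fin k} (p≢q : p ≢ q)
                    (noP : ¬ Seen a p) (noQ : ¬ Seen a q) (rich : Rich a) where

    p≢ : ∀ {x y z} → colour x y ≡ p → a ≢ z → colour x y ≢ colour a z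
    p≢ {z = z} xy≡p a≢z eq = noP (z , a≢z , trans (sym eq) xy≡p)

    q≢ : ∀ {x y z} → colour x y ≡ q → a ≢ z → colour x y ≢ colour a z
    q≢ {z = z} xy≡q a≢z eq = noQ (z , a≢z , trans (sym eq) xy≡q)

    -- All colours seen by `a` avoid `p` and `q`, so `rich` alone supplies the vertices that `Fork`
    -- asks for.
    adjacent : ∀ {x y w} → x ≢ y → y ≢ w → colour x y ≡ p → colour y w ≡ q → ⊥
    adjacent {x} {y} {w} x≢y y≢w xy≡p yw≡q =
      Fork.impossible (off noP x≢y xy≡p) (off noP (≢-sym x≢y) (flip xy≡p))
        (off noQ (≢-sym y≢w) (flip yw≡q)) x≢y
        (λ { refl → p≢q (trans (sym xy≡p) (flip yw≡q)) }) y≢w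
        (λ eq → p≢q (trans (sym xy≡p) (trans eq yw≡q)))
        (λ c₁ c₂ → let z , a≢z , avoids = rich c₁ c₂ in
           z , a≢z , ≢-sym (p≢ xy≡p a≢z) ∷ ≢-sym (q≢ yw≡q a≢z) ∷ avoids)

    -- Otherwise x ─ y ─ a ─ z ─ w is rainbow, since `a` sees neither `p` nor `q`.
    bridge : ∀ {x y z w} → x ≢ y → z ≢ w → x ≢ z → x ≢ w → y ≢ z → y ≢ w →
             colour x y ≡ p → colour z w ≡ q → colour a y ≡ colour a z
    bridge {x} {y} {z} {w} x≢y z≢w x≢z x≢w y≢z y≢w xy≡p zw≡q =
      decidable-stable (colour a y ≟ colour a z) λ ay≢az →
        from-just (refutation (a ∷ x ∷ y ∷ w ∷ z ∷ [])
          ((𝕒 , 𝕩) ∷ (𝕒 , 𝕪) ∷ (𝕒 , 𝕨) ∷ (𝕒 , 𝕫) ∷ (𝕩 , 𝕪) ∷ (𝕩 , 𝕨) ∷ (𝕪 , 𝕨) ∷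
           (𝕩 , 𝕫) ∷ (𝕪 , 𝕫) ∷ (𝕫 , 𝕨) ∷ [])
          (((𝕩 , 𝕪) , (𝕫 , 𝕨)) ∷ ((𝕒 , 𝕪) , (𝕒 , 𝕫)) ∷
           ((𝕩 , 𝕪) , (𝕒 , 𝕪)) ∷ ((𝕫 , 𝕨) , (𝕒 , 𝕪)) ∷
           ((𝕩 , 𝕪) , (𝕒 , 𝕫)) ∷ ((𝕫 , 𝕨) , (𝕒 , 𝕫)) ∷ [])
          []
          ((𝕩 ─ 𝕪 ─ 𝕒 ─ 𝕫 ─ 𝕨) ∷ []))
          (off noP x≢y xy≡p ∷ a≢y ∷ off noQ (≢-sym z≢w) (flip zw≡q) ∷ a≢z ∷
           x≢y ∷ x≢w ∷ y≢w ∷ x≢z ∷ y≢z ∷ z≢w ∷ [])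
          ((λ eq → p≢q (trans (sym xy≡p) (trans eq zw≡q))) ∷ ay≢az ∷
           p≢ xy≡p a≢y ∷ q≢ zw≡q a≢y ∷ p≢ xy≡p a≢z ∷ q≢ zw≡q a≢z ∷ [])
          []
      where
      a≢y = off noP (≢-sym x≢y) (flip xy≡p)
      a≢z = off noQ z≢w zw≡q

    -- By `bridge`, `a` is joined to all four ends in one colour; `u` and `v` show two others. The
    -- first two paths give that colour to w y, the next two give x u the colour of a u, and then z
    -- ─ w ─ y ─ x ─ u is rainbow.
    disjoint : ∀ {x y z w} → x ≢ y → z ≢ w → x ≢ z → x ≢ w → y ≢ z → y ≢ w →
               colour x y ≡ p → colour z w ≡ q → ⊥
    disjoint {x} {y} {z} {w} x≢y z≢w x≢z x≢w y≢z y≢w xy≡p zw≡q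
      with u , a≢u , u≢x ∷ _ ← rich (colour a x) (colour a x)
      with v , a≢v , v≢x ∷ v≢u ∷ [] ← rich (colour a x) (colour a u) =
      from-just (refutation (a ∷ x ∷ y ∷ w ∷ z ∷ u ∷ v ∷ [])
        ((𝕒 , 𝕩) ∷ (𝕒 , 𝕪) ∷ (𝕒 , 𝕨) ∷ (𝕒 , 𝕫) ∷ (𝕒 , 𝕦) ∷ (𝕒 , 𝕧) ∷
         (𝕩 , 𝕪) ∷ (𝕫 , 𝕨) ∷ (𝕩 , 𝕫) ∷ (𝕩 , 𝕨) ∷ (𝕪 , 𝕫) ∷ (𝕪 , 𝕨) ∷
         (𝕪 , 𝕦) ∷ (𝕫 , 𝕦) ∷ (𝕨 , 𝕦) ∷ (𝕪 , 𝕧) ∷ (𝕫 , 𝕧) ∷ (𝕨 , 𝕧) ∷ [])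
        (((𝕒 , 𝕦) , (𝕒 , 𝕩)) ∷ ((𝕒 , 𝕧) , (𝕒 , 𝕩)) ∷ ((𝕒 , 𝕧) , (𝕒 , 𝕦)) ∷
         ((𝕩 , 𝕪) , (𝕫 , 𝕨)) ∷
         ((𝕩 , 𝕪) , (𝕒 , 𝕩)) ∷ ((𝕩 , 𝕪) , (𝕒 , 𝕦)) ∷ ((𝕩 , 𝕪) , (𝕒 , 𝕧)) ∷
         ((𝕫 , 𝕨) , (𝕒 , 𝕩)) ∷ ((𝕫 , 𝕨) , (𝕒 , 𝕦)) ∷ ((𝕫 , 𝕨) , (𝕒 , 𝕧)) ∷ [])
        ((((𝕒 , 𝕪) , (𝕒 , 𝕩)) ∷ []) ∷ (((𝕒 , 𝕫) , (𝕒 , 𝕩)) ∷ []) ∷ (((𝕒 , 𝕨) , (𝕒 , 𝕩)) ∷ []) ∷ [])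
        ((𝕨 ─ 𝕪 ─ 𝕩 ─ 𝕒 ─ 𝕦) ∷ (𝕪 ─ 𝕨 ─ 𝕫 ─ 𝕒 ─ 𝕧) ∷ (𝕪 ─ 𝕩 ─ 𝕦 ─ 𝕒 ─ 𝕧) ∷
         (𝕩 ─ 𝕦 ─ 𝕒 ─ 𝕫 ─ 𝕨) ∷ (𝕫 ─ 𝕨 ─ 𝕪 ─ 𝕩 ─ 𝕦) ∷ []))
        (a≢x ∷ off noP (≢-sym x≢y) (flip xy≡p) ∷ off noQ (≢-sym z≢w) (flip zw≡q) ∷
         off noQ z≢w zw≡q ∷ a≢u ∷ a≢v ∷
         x≢y ∷ z≢w ∷ x≢z ∷ x≢w ∷ y≢z ∷ y≢w ∷
         (λ { refl → u≢x y≡x }) ∷ (λ { refl → u≢x z≡x }) ∷ (λ { refl → u≢x w≡x }) ∷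
         (λ { refl → v≢x y≡x }) ∷ (λ { refl → v≢x z≡x }) ∷ (λ { refl → v≢x w≡x }) ∷ [])
        (u≢x ∷ v≢x ∷ v≢u ∷ (λ eq → p≢q (trans (sym xy≡p) (trans eq zw≡q))) ∷
         p≢ xy≡p a≢x ∷ p≢ xy≡p a≢u ∷ p≢ xy≡p a≢v ∷
         q≢ zw≡q a≢x ∷ q≢ zw≡q a≢u ∷ q≢ zw≡q a≢v ∷ [])
        ((λ { (y≢x ∷ []) → y≢x y≡x }) ∷ (λ { (z≢x ∷ []) → z≢x z≡x }) ∷
         (λ { (w≢x ∷ []) → w≢x w≡x }) ∷ [])
      where
      a≢x = off noP x≢y xy≡p
      z≡x : colour a z ≡ colour a x
      z≡x = sym (bridge (≢-sym x≢y) z≢w y≢z y≢w x≢z x≢w (flip xy≡p) zw≡q)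
      w≡x : colour a w ≡ colour a x
      w≡x = sym (bridge (≢-sym x≢y) (≢-sym z≢w) y≢w y≢z x≢w x≢z (flip xy≡p) (flip zw≡q))
      y≡x : colour a y ≡ colour a x
      y≡x = trans (bridge x≢y z≢w x≢z x≢w y≢z y≢w xy≡p zw≡q) z≡x

    impossible : ∀ {x y z w} → x ≢ y → z ≢ w → colour x y ≡ p → colour z w ≡ q → ⊥
    impossible {x} {y} {z} {w} x≢y z≢w xy≡p zw≡q with x ≟ z | x ≟ w | y ≟ z | y ≟ w
    ... | yes refl | _        | _        | _        = adjacent (≢-sym x≢y) z≢w (flip xy≡p) zw≡q
    ... | _        | yes refl | _        | _        =
      adjacent (≢-sym x≢y) (≢-sym z≢w) (flip xy≡p) (flip zw≡q)
    ... | _        | _        | yes refl | _        = adjacent x≢y z≢w xy≡p zw≡q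
    ... | _        | _        | _        | yes refl = adjacent x≢y (≢-sym z≢w) xy≡p (flip zw≡q)
    ... | no x≢z   | no x≢w   | no y≢z   | no y≢w   =
      disjoint x≢y z≢w x≢z x≢w y≢z y≢w xy≡p zw≡q

  -- Whether `a` sees the colour of x y is left open, which covers both cases of `monochromaticOff`.
  module OneMissing {a x y : Fin n} (a≢x : a ≢ x) (a≢y : a ≢ y) (x≢y : x ≢ y)
                    (seen : ∀ c → c ≢ colour x y → Seen a c) where

    p : Fin k
    p = colour x y

    -- With at least five colours, one avoids the four listed; being other than `p`, it is seen by
    -- `a`.
    pick : ∀ q c₁ c₂ → Pick a (p ∷ q ∷ c₁ ∷ c₂ ∷ [])
    pick q c₁ c₂ with c , avoids@(c≢p ∷ _) ← fresh (p ∷ q ∷ c₁ ∷ c₂ ∷ []) 4<k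
                 with z , a≢z , refl ← seen c c≢p = z , a≢z , avoids

    step : ∀ {u v w} → a ≢ u → a ≢ v → a ≢ w → u ≢ v → v ≢ w →
           colour u v ≡ p → colour v w ≡ p
    step {u} {v} {w} a≢u a≢v a≢w u≢v v≢w uv≡p with u ≟ w
    ... | yes refl = flip uv≡p
    ... | no  u≢w  = decidable-stable (colour v w ≟ p) λ vw≢p →
      Fork.impossible a≢u a≢v a≢w u≢v u≢w v≢w (λ eq → vw≢p (trans (sym eq) uv≡p))
        (λ c₁ c₂ → subst (λ c → Pick a (c ∷ colour v w ∷ c₁ ∷ c₂ ∷ [])) (sym uv≡p)
                     (pick (colour v w) c₁ c₂))

    monochromatic : ∀ u v → a ≢ u → a ≢ v → u ≢ v → colour u v ≡ p
    monochromatic u v a≢u a≢v u≢v with x ≟ u | x ≟ v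
    ... | yes refl | _        = step a≢y a≢u a≢v (≢-sym x≢y) u≢v (flip refl)
    ... | no  _    | yes refl = flip (step a≢y a≢v a≢u (≢-sym x≢y) (≢-sym u≢v) (flip refl))
    -- The colour `p` spreads along the walk y, x, u, v.
    ... | no  x≢u  | no  _    =
      step a≢x a≢u a≢v x≢u u≢v (step a≢y a≢x a≢u (≢-sym x≢y) x≢u (flip refl))

  -- By `TwoMissing`, `a` misses at most one colour. The spreading starts from an edge of the
  -- missing colour or, if there is none, from any edge off `a`.
  monochromaticOff : Exact χ → ∀ {a} → Rich a →
                     ∃ λ p → ∀ u v → a ≢ u → a ≢ v → u ≢ v → colour u v ≡ p
  monochromaticOff exact {a} rich with all? (seen? a)
  ... | yes seen
    with x , x≢a ∷ [] ← fresh (a ∷ []) (≤-trans (s≤s (s≤s z≤n)) 4<n)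
    with y , y≢a ∷ y≢x ∷ [] ← fresh (a ∷ x ∷ []) (≤-trans (s≤s (s≤s (s≤s z≤n))) 4<n) =
    _ , OneMissing.monochromatic (≢-sym x≢a) (≢-sym y≢a) (≢-sym y≢x) (λ c _ → seen c)
  ... | no ¬seen
    with p , noP ← ¬∀⟶∃¬ k (Seen a) (seen? a) ¬seen
    with x , y , x≢y , refl ← exact p =
    p , OneMissing.monochromatic (off noP x≢y refl) (off noP (≢-sym x≢y) (flip refl)) x≢y
      λ q q≢p → decidable-stable (seen? a q) λ noQ →
        let _ , _ , z≢w , zw≡q = exact q in
        TwoMissing.impossible (≢-sym q≢p) noP noQ rich x≢y z≢w refl zw≡q

-- All vertices see at most two colours: the dominant colour

module TwoColoured {k n} (χ : Coloring k n) where
  open Coloring χ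
  open Palette χ

  atMostTwo : ∀ {a b c d} → Poor a → Seen a b → Seen a c → Seen a d →
              b ≢ c → d ≢ b → d ≡ c
  atMostTwo (_ , _ , two) (x , a≢x , refl) (y , a≢y , refl) (z , a≢z , refl) b≢c d≢b
    with two x a≢x | two y a≢y | two z a≢z
  ... | inj₁ b | inj₁ c | _      = ⊥-elim (b≢c (trans b (sym c)))
  ... | inj₂ b | inj₂ c | _      = ⊥-elim (b≢c (trans b (sym c)))
  ... | inj₁ b | inj₂ c | inj₁ d = ⊥-elim (d≢b (trans d (sym b)))
  ... | inj₁ b | inj₂ c | inj₂ d = trans d (sym c)
  ... | inj₂ b | inj₁ c | inj₁ d = trans d (sym c)
  ... | inj₂ b | inj₁ c | inj₂ d = ⊥-elim (d≢b (trans d (sym b)))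

  module _ (poor : ∀ a → Poor a) (exact : Exact χ) (3<k : 3 < k) (1<n : 1 < n) where

    -- A vertex z on an edge of a fourth colour δ has one more colour, which would
    -- have to be common to the colours seen by u, by v and by w.
    noTriangle : ∀ {u v w} → u ≢ v → u ≢ w → v ≢ w → colour u v ≢ colour u w →
                 colour v w ≢ colour u v → colour v w ≢ colour u w → ⊥
    noTriangle {u} {v} {w} u≢v u≢w v≢w β≢α γ≢β γ≢α
      with δ , δ≢α ∷ δ≢β ∷ δ≢γ ∷ [] ← fresh (colour u w ∷ colour u v ∷ colour v w ∷ []) 3<k
      with z , z′ , z≢z′ , zz′≡δ ← exact δ = impossible
      where
      u∌δ : ¬ Seen u δ
      u∌δ s = δ≢α (atMostTwo (poor u) (sees u≢v) (sees u≢w) s β≢α δ≢β)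
      v∌δ : ¬ Seen v δ
      v∌δ s = δ≢γ (atMostTwo (poor v) (seesʳ u≢v) (sees v≢w) s (≢-sym γ≢β) δ≢β)
      w∌δ : ¬ Seen w δ
      w∌δ s = δ≢γ (atMostTwo (poor w) (seesʳ u≢w) (seesʳ v≢w) s (≢-sym γ≢α) δ≢α)
      ≢z : ∀ {x} → ¬ Seen x δ → x ≢ z
      ≢z x∌δ refl = x∌δ (z′ , z≢z′ , zz′≡δ)
      same : ∀ {x y} → ¬ Seen x δ → ¬ Seen y δ → colour y z ≡ colour x z
      same x∌δ y∌δ = atMostTwo (poor z) (z′ , z≢z′ , zz′≡δ) (seesʳ (≢z x∌δ)) (seesʳ (≢z y∌δ))
        (λ eq → x∌δ (z , ≢z x∌δ , sym eq)) (λ eq → y∌δ (z , ≢z y∌δ , eq))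
      impossible : ⊥
      impossible with colour u z ≟ colour u v
      ... | yes uz≡β = γ≢β (sym (atMostTwo (poor w) (seesʳ u≢w) (seesʳ v≢w)
                              (z , ≢z w∌δ , trans (same u∌δ w∌δ) uz≡β) (≢-sym γ≢α) β≢α))
      ... | no  uz≢β = γ≢α (trans (sym vz≡γ) (trans (same u∌δ v∌δ) uz≡α))
        where
        uz≡α : colour u z ≡ colour u w
        uz≡α = atMostTwo (poor u) (sees u≢v) (sees u≢w) (sees (≢z u∌δ)) β≢α uz≢β
        vz≡γ : colour v z ≡ colour v w
        vz≡γ = atMostTwo (poor v) (seesʳ u≢v) (sees v≢w) (sees (≢z v∌δ)) (≢-sym γ≢β)
                 (λ eq → uz≢β (trans (same v∌δ u∌δ) eq))

    -- Let α be the colour of u u′ and β that of u v. If `v` misses α and `w` misses β, then u w has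
    -- colour α and v w has neither colour, against `noTriangle`.
    dominant : ∃[ α ] ∀ v → Seen v α
    dominant
      with u , [] ← fresh [] (≤-trans (s≤s z≤n) 1<n)
      with u′ , u′≢u ∷ [] ← fresh (u ∷ []) 1<n
      with all? (λ v → seen? v (colour u u′))
    ... | yes all = _ , all
    ... | no ¬all
      with v , v∌α ← ¬∀⟶∃¬ n _ (λ v → seen? v (colour u u′)) ¬all
      with all? (λ w → seen? w (colour u v))
    ...   | yes all = _ , all
    ...   | no ¬all′
      with w , w∌β ← ¬∀⟶∃¬ n _ (λ w → seen? w (colour u v)) ¬all′ =
      ⊥-elim (noTriangle u≢v u≢w v≢w (λ eq → uw≢β (sym eq))
        (λ eq → w∌β (v , ≢-sym v≢w , trans (colour-sym w v) eq))
        (λ eq → v∌α (w , v≢w , trans eq uw≡α)))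
      where
      u∋α : Seen u (colour u u′)
      u∋α = sees (≢-sym u′≢u)
      u≢v : u ≢ v
      u≢v refl = v∌α u∋α
      u≢w : u ≢ w
      u≢w refl = w∌β (sees u≢v)
      v≢w : v ≢ w
      v≢w refl = w∌β (seesʳ u≢v)
      β≢α : colour u v ≢ colour u u′
      β≢α eq = v∌α (u , ≢-sym u≢v , trans (colour-sym v u) eq)
      uw≢β : colour u w ≢ colour u v
      uw≢β eq = w∌β (u , ≢-sym u≢w , trans (colour-sym w u) eq)
      uw≡α : colour u w ≡ colour u u′
      uw≡α = atMostTwo (poor u) (sees u≢v) u∋α (sees u≢w) β≢α uw≢β

    module _ {α : Fin k} (everywhere : ∀ v → Seen v α) where

      -- Besides `α`, `v` sees only `c` and `v′` only `c′`; an edge between them of another colour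
      -- would have both.
      separate : ∀ {v v′ c c′} → Seen v c → Seen v′ c′ → c ≢ c′ → c ≢ α → c′ ≢ α →
                 v ≢ v′ × colour v v′ ≡ α
      separate {v} {v′} {c} {c′} v∋c v′∋c′ c≢c′ c≢α c′≢α = v≢v′ ,
        decidable-stable (colour v v′ ≟ α) λ d≢α → c≢c′ (trans
          (sym (atMostTwo (poor v) (everywhere v) v∋c (sees v≢v′) (≢-sym c≢α) d≢α))
          (atMostTwo (poor v′) (everywhere v′) v′∋c′ (seesʳ v≢v′) (≢-sym c′≢α) d≢α))
        where
        v≢v′ : v ≢ v′
        v≢v′ refl = c≢c′ (sym (atMostTwo (poor v) (everywhere v) v∋c v′∋c′ (≢-sym c≢α) c′≢α))

-- Embedding `H` in the dominant colour

copyInK : ∀ {m n} {G : Graph m} {f : Fin m → Fin n} → Injective _≡_ _≡_ f → Copy G (K n)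
copyInK {G = G} {f} inj = record
  { map       = f
  ; injective = inj
  ; preserves = λ u~v fu≡fv → Graph.~-irrefl G (inj fu≡fv) u~v
  }

transpose-left : ∀ {n} (i j : Fin n) → transpose i j i ≡ j
transpose-left i j rewrite dec-true (i ≟ i) refl = refl

transpose-injective : ∀ {n} (i j : Fin n) → Injective _≡_ _≡_ (transpose i j)
transpose-injective i j eq =
  trans (sym (transpose-inverse j i)) (trans (cong (transpose j i) eq) (transpose-inverse j i))

module DominantColour {k n} (χ : Coloring k n)
                      (poor : ∀ a → Palette.Poor χ a) (exact : Exact χ)
                      (3<k : 3 < k) (1<n : 1 < n)
                      {α : Fin k} (everywhere : ∀ v → Palette.Seen χ v α) (H : Graph k)
                      {s s′ : Fin k} (s≢s′ : s ≢ s′) (s≁s′ : ¬ Graph._~_ H s s′) where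
  open Coloring χ
  open Palette χ
  open TwoColoured χ
  open Graph H

  -- f maps s and s′ to the ends of an edge of colour σ s, and any other i to an end
  -- of an edge of colour σ i; these colours differ from α because σ s′ ≡ α.
  σ : Fin k → Fin k
  σ = transpose s′ α

  σ≢α : ∀ {i} → i ≢ s′ → σ i ≢ α
  σ≢α i≢s′ eq = i≢s′ (transpose-injective s′ α (trans eq (sym (transpose-left s′ α))))

  τ : Fin k → Fin k
  τ i with i ≟ s′
  ... | yes _ = σ s
  ... | no  _ = σ i

  f : Fin k → Fin n
  f i with i ≟ s′
  ... | yes _ = proj₁ (proj₂ (exact (σ s)))
  ... | no  _ = proj₁ (exact (σ i))

  τ≢α : ∀ i → τ i ≢ α
  τ≢α i with i ≟ s′
  ... | yes _    = σ≢α s≢s′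
  ... | no  i≢s′ = σ≢α i≢s′

  f-sees : ∀ i → Seen (f i) (τ i)
  f-sees i with i ≟ s′
  ... | yes _ = let u , v , u≢v , uv≡c = exact (σ s) in u , ≢-sym u≢v , trans (colour-sym v u) uv≡c
  ... | no  _ = let u , v , u≢v , uv≡c = exact (σ i) in v , u≢v , uv≡c

  τ-collision : ∀ {i j} → i ≢ j → τ i ≡ τ j → (i ≡ s × j ≡ s′) ⊎ (i ≡ s′ × j ≡ s)
  τ-collision {i} {j} i≢j eq with i ≟ s′ | j ≟ s′
  ... | yes i≡s′ | yes j≡s′ = ⊥-elim (i≢j (trans i≡s′ (sym j≡s′)))
  ... | yes i≡s′ | no  _    = inj₂ (i≡s′ , sym (transpose-injective s′ α eq))
  ... | no  _    | yes j≡s′ = inj₁ (transpose-injective s′ α eq , j≡s′)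
  ... | no  _    | no  _    = ⊥-elim (i≢j (transpose-injective s′ α eq))

  -- These are the two ends of the edge supplied by `exact (σ s)`.
  fs≢fs′ : f s ≢ f s′
  fs≢fs′ with s ≟ s′ | s′ ≟ s′
  ... | yes s≡s′ | _        = ⊥-elim (s≢s′ s≡s′)
  ... | no  _    | yes _    = proj₁ (proj₂ (proj₂ (exact (σ s))))
  ... | no  _    | no s′≢s′ = ⊥-elim (s′≢s′ refl)

  separated : ∀ i j → τ i ≢ τ j → f i ≢ f j × colour (f i) (f j) ≡ α
  separated i j τi≢τj =
    separate poor exact 3<k 1<n everywhere (f-sees i) (f-sees j) τi≢τj (τ≢α i) (τ≢α j)

  f-injective : Injective _≡_ _≡_ f
  f-injective {i} {j} fi≡fj = decidable-stable (i ≟ j) λ i≢j → case i≢j (τ i ≟ τ j)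
    where
    case : i ≢ j → Dec (τ i ≡ τ j) → ⊥
    case i≢j (no τi≢τj) = proj₁ (separated i j τi≢τj) fi≡fj
    case i≢j (yes eq) with τ-collision i≢j eq
    ... | inj₁ (refl , refl) = fs≢fs′ fi≡fj
    ... | inj₂ (refl , refl) = fs≢fs′ (sym fi≡fj)

  -- `separate` fails only for the pair `s`, `s′`, which is not an edge of `H`.
  edge-colour : ∀ {i j} → i ~ j → colour (f i) (f j) ≡ α
  edge-colour {i} {j} i~j =
    proj₂ (separated i j λ eq → case (τ-collision (λ i≡j → ~-irrefl i≡j i~j) eq))
    where
    case : (i ≡ s × j ≡ s′) ⊎ (i ≡ s′ × j ≡ s) → ⊥
    case (inj₁ (refl , refl)) = s≁s′ i~j
    case (inj₂ (refl , refl)) = s≁s′ (~-sym i~j)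

  copy : ∃ λ (copy : Copy H (K n)) → Monochromatic χ copy
  copy = copyInK f-injective , α , edge-colour

-- Rainbow copies of `P 5`

lookup-injective : {A : Set} {xs : List A} → Unique xs → Injective _≡_ _≡_ (List.lookup xs)
lookup-injective (_  ∷ _) {zero}  {zero}  _  = refl
lookup-injective (x∉ ∷ _) {zero}  {suc j} eq = ⊥-elim (All.lookup x∉ (∈-lookup j) eq)
lookup-injective (x∉ ∷ _) {suc i} {zero}  eq = ⊥-elim (All.lookup x∉ (∈-lookup i) (sym eq))
lookup-injective (_  ∷ u) {suc i} {suc j} eq = cong suc (lookup-injective u eq)

successor : ∀ {m} {u v : Fin (suc m)} → suc (toℕ u) ≡ toℕ v → ∃[ i ] u ≡ inject₁ i × v ≡ suc i
successor {v = suc i} eq =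
  i , toℕ-injective (trans (ℕ.suc-injective eq) (sym (toℕ-inject₁ i))) , refl

-- Indexing the edges, up to direction, lets equal colours be read as equal positions in a list
-- without repetitions.
path-edge : ∀ {m} {u v : Fin (suc m)} → Graph._~_ (P (suc m)) u v →
            ∃[ i ] ((u ≡ inject₁ i × v ≡ suc i) ⊎ (u ≡ suc i × v ≡ inject₁ i))
path-edge (inj₁ eq) with i , u≡ , v≡ ← successor eq = i , inj₁ (u≡ , v≡)
path-edge (inj₂ eq) with i , v≡ , u≡ ← successor eq = i , inj₂ (u≡ , v≡)

module _ {k n} (χ : Coloring k n) where
  open Coloring χ

  rainbowCopy : ∀ {a b c d e} → Unique (a ∷ b ∷ c ∷ d ∷ e ∷ []) →
    Unique (colour a b ∷ colour b c ∷ colour c d ∷ colour d e ∷ []) →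
    ∃ λ (copy : Copy (P 5) (K n)) → Rainbow χ copy
  rainbowCopy {a} {b} {c} {d} {e} uniqueᵛ uniqueᶜ =
    copyInK (lookup-injective uniqueᵛ) , rainbow
    where
    f : Fin 5 → Fin n
    f = List.lookup (a ∷ b ∷ c ∷ d ∷ e ∷ [])

    g : Fin 4 → Fin k
    g = List.lookup (colour a b ∷ colour b c ∷ colour c d ∷ colour d e ∷ [])

    forward : ∀ i → colour (f (inject₁ i)) (f (suc i)) ≡ g i
    forward 0F = refl
    forward 1F = refl
    forward 2F = refl
    forward 3F = refl

    backward : ∀ i → colour (f (suc i)) (f (inject₁ i)) ≡ g i
    backward i = trans (colour-sym _ _) (forward i)

    same : ∀ i j {c₁ c₂} → c₁ ≡ g i → c₂ ≡ g j → c₁ ≡ c₂ → i ≡ j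
    same _ _ c₁≡ c₂≡ eq = lookup-injective uniqueᶜ (trans (sym c₁≡) (trans eq c₂≡))

    rainbow : ∀ {u v x y} → Graph._~_ (P 5) u v → Graph._~_ (P 5) x y →
              colour (f u) (f v) ≡ colour (f x) (f y) → (u ≡ x × v ≡ y) ⊎ (u ≡ y × v ≡ x)
    rainbow {u} {v} {x} {y} u~v x~y eq with path-edge {u = u} {v} u~v | path-edge {u = x} {y} x~y
    ... | i , inj₁ (refl , refl) | j , inj₁ (refl , refl)
      with refl ← same i j (forward i) (forward j) eq = inj₁ (refl , refl)
    ... | i , inj₁ (refl , refl) | j , inj₂ (refl , refl)
      with refl ← same i j (forward i) (backward j) eq = inj₂ (refl , refl)
    ... | i , inj₂ (refl , refl) | j , inj₁ (refl , refl)
      with refl ← same i j (backward i) (forward j) eq = inj₂ (refl , refl)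
    ... | i , inj₂ (refl , refl) | j , inj₂ (refl , refl)
      with refl ← same i j (backward i) (backward j) eq = inj₁ (refl , refl)

  rainbowPath? : (∃ λ (copy : Copy (P 5) (K n)) → Rainbow χ copy) ⊎ NoRainbow χ
  rainbowPath? with (any? λ a → any? λ b → any? λ c → any? λ d → any? λ e →
    unique? _≟_ (a ∷ b ∷ c ∷ d ∷ e ∷ []) ×-dec
    unique? _≟_ (colour a b ∷ colour b c ∷ colour c d ∷ colour d e ∷ []))
  ... | yes (_ , _ , _ , _ , _ , uniqueᵛ , uniqueᶜ) = inj₁ (rainbowCopy uniqueᵛ uniqueᶜ)
  ... | no none = inj₂ λ a b c d e uniqueᵛ uniqueᶜ → none (a , b , c , d , e , uniqueᵛ , uniqueᶜ)

-- The upper bound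

nonAdjacent : ∀ {t} (H : Graph t) → ¬ Complete H →
              ∃[ u ] ∃[ v ] u ≢ v × ¬ Graph._~_ H u v
nonAdjacent H ¬complete
  with (any? λ u → any? λ v → ¬? (u ≟ v) ×-dec ¬? (Graph._~?_ H u v))
... | yes found = found
... | no none   = ⊥-elim (¬complete λ u v u≢v →
  decidable-stable (u ~? v) λ u≁v → none (u , v , u≢v , u≁v))
  where open Graph H

forced : ∀ {k n} → 4 < k → k < n → (H : Graph k) → ¬ Complete H →
         (χ : Coloring k n) → Exact χ → NoRainbow χ →
         ∃ λ (copy : Copy H (K n)) → Monochromatic χ copy
forced {k} {suc n} 4<k k<n@(s≤s k≤n) H ¬complete χ exact noRainbow = go
  where
  open Coloring χ
  open Palette χ
  open TwoColoured χ
  open RainbowFree χ noRainbow 4<k (ℕ.<-trans 4<k k<n)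

  -- `punchIn a` enumerates the `n` vertices other than `a`, and `k ≤ n` leaves room for `H` among
  -- them.
  offVertex : ∀ a {p} → (∀ u v → a ≢ u → a ≢ v → u ≢ v → colour u v ≡ p) →
              ∃ λ (copy : Copy H (K (suc n))) → Monochromatic χ copy
  offVertex a mono = copyInK inj , _ , λ u~v →
    mono _ _ (≢-sym (punchInᵢ≢i a _)) (≢-sym (punchInᵢ≢i a _))
      (λ eq → Graph.~-irrefl H (inj eq) u~v)
    where
    inj : Injective _≡_ _≡_ (λ i → punchIn a (inject≤ i k≤n))
    inj eq = inject≤-injective k≤n k≤n _ _ (punchIn-injective a _ _ eq)

  go : ∃ λ (copy : Copy H (K (suc n))) → Monochromatic χ copy
  go with any? rich?
  ... | yes (a , rich) = offVertex a (proj₂ (monochromaticOff exact rich))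
  ... | no  none
    with _ , _ , s≢s′ , s≁s′ ← nonAdjacent H ¬complete
    = DominantColour.copy χ poor′ exact 3<k 1<n (proj₂ (dominant poor′ exact 3<k 1<n)) H s≢s′ s≁s′
    where
    poor′ = λ a → ¬rich⇒poor (none ∘ (a ,_))
    3<k = ℕ.<-trans (ℕ.n<1+n 3) 4<k
    1<n = ≤-trans (s≤s (s≤s z≤n)) (ℕ.<-trans 4<k k<n)

-- The lower bound: the star colouring

-- The vertex zero is the centre; the value at (zero , zero) is junk.
star : ∀ {m} → Fin (suc m) → Fin (suc m) → Fin (suc m)
star zero    v       = v
star u       zero    = u
star (suc _) (suc _) = zero

star-sym : ∀ {m} (u v : Fin (suc m)) → star u v ≡ star v u
star-sym zero    zero    = refl
star-sym zero    (suc _) = refl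
star-sym (suc _) zero    = refl
star-sym (suc _) (suc _) = refl

star-off : ∀ {m} {u v : Fin (suc m)} → u ≢ zero → v ≢ zero → star u v ≡ zero
star-off {u = zero}              u≢0 _   = ⊥-elim (u≢0 refl)
star-off {u = suc _} {v = zero}  _   v≢0 = ⊥-elim (v≢0 refl)
star-off {u = suc _} {v = suc _} _   _   = refl

starColoring : ∀ m → Coloring (suc m) (suc m)
starColoring m = record { colour = star ; colour-sym = star-sym }

star-exact : ∀ {m} → 2 ≤ m → Exact (starColoring m)
star-exact (s≤s (s≤s _)) zero    = 1F , 2F , (λ ()) , refl
star-exact _             (suc c) = zero , suc c , (λ ()) , refl

-- The centre meets at most two of the four edges of the path; two edges that miss it share the
-- colour `zero`.
star-noRainbow : ∀ {m} (copy : Copy (P 5) (K (suc m))) → ¬ Rainbow (starColoring m) copy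
star-noRainbow copy rainbow = refute (f 1F ≟ zero) (f 2F ≟ zero) (f 3F ≟ zero)
  where
  open Copy copy renaming (map to f)

  clash : ∀ i j → f (inject₁ i) ≢ zero → f (suc i) ≢ zero →
          f (inject₁ j) ≢ zero → f (suc j) ≢ zero →
          (inject₁ i ≡ inject₁ j × suc i ≡ suc j) ⊎ (inject₁ i ≡ suc j × suc i ≡ inject₁ j)
  clash i j i≢ si≢ j≢ sj≢ =
    rainbow (inj₁ (cong suc (toℕ-inject₁ i))) (inj₁ (cong suc (toℕ-inject₁ j)))
      (trans (star-off i≢ si≢) (sym (star-off j≢ sj≢)))

  elsewhere : ∀ {i j} → f i ≡ zero → j ≢ i → f j ≢ zero
  elsewhere i↦0 j≢i j↦0 = j≢i (injective (trans j↦0 (sym i↦0)))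

  refute : Dec (f 1F ≡ zero) → Dec (f 2F ≡ zero) → Dec (f 3F ≡ zero) → ⊥
  refute (no 1≢) (no 2≢) (no 3≢)
    with clash 1F 2F 1≢ 2≢ 2≢ 3≢
  ... | inj₁ (() , _)
  ... | inj₂ (() , _)
  refute (yes 1↦0) _ _
    with clash 2F 3F (elsewhere 1↦0 λ ()) (elsewhere 1↦0 λ ())
                     (elsewhere 1↦0 λ ()) (elsewhere 1↦0 λ ())
  ... | inj₁ (() , _)
  ... | inj₂ (() , _)
  refute _ (yes 2↦0) _
    with clash 0F 3F (elsewhere 2↦0 λ ()) (elsewhere 2↦0 λ ())
                     (elsewhere 2↦0 λ ()) (elsewhere 2↦0 λ ())
  ... | inj₁ (() , _)
  ... | inj₂ (() , _)
  refute _ _ (yes 3↦0)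
    with clash 0F 1F (elsewhere 3↦0 λ ()) (elsewhere 3↦0 λ ())
                     (elsewhere 3↦0 λ ()) (elsewhere 3↦0 λ ())
  ... | inj₁ (() , _)
  ... | inj₂ (() , _)

-- Pigeonhole on `y` followed by the values of `f`: injectivity leaves only a collision with `y`.
injective⇒surjective : ∀ {n} {f : Fin n → Fin n} → Injective _≡_ _≡_ f → ∀ y → ∃[ x ] f x ≡ y
injective⇒surjective {n} {f} inj y with pigeonhole (ℕ.n<1+n n) g
  where
  g : Fin (suc n) → Fin n
  g zero    = y
  g (suc i) = f i
... | zero  , suc j , _   , y≡fj  = j , sym y≡fj
... | suc i , suc j , i<j , fi≡fj = ⊥-elim (<⇒≢ i<j (cong suc (inj fi≡fj)))

-- A spanning copy uses the centre, say at `s`, and an edge s s₁ fixes the colour `f s₁`. An edge at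
-- a third vertex `s₂` has colour `f s₂` if it leads to `s`, and `zero` otherwise.
star-noMonochromatic : ∀ {m} → 3 ≤ m → (H : Graph (suc m)) → NoIsolatedVertex H →
                       (copy : Copy H (K (suc m))) → ¬ Monochromatic (starColoring m) copy
star-noMonochromatic 3≤m H noIsolated copy (c , mono)
  with s , fs≡0 ← injective⇒surjective (Copy.injective copy) zero
  with s₁ , s~s₁ ← noIsolated s
  with s₂ , s₂≢s ∷ s₂≢s₁ ∷ [] ← fresh (s ∷ s₁ ∷ []) (≤-trans 3≤m (ℕ.n≤1+n _))
  with s₃ , s₂~s₃ ← noIsolated s₂ = final
  where
  open Graph H
  open Copy copy renaming (map to f)

  c≡fs₁ : c ≡ f s₁
  c≡fs₁ = trans (sym (mono s~s₁)) (cong (λ x → star x (f s₁)) fs≡0)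

  ≢0 : ∀ {x} → x ≢ s → f x ≢ zero
  ≢0 x≢s fx≡0 = x≢s (injective (trans fx≡0 (sym fs≡0)))

  final : ⊥
  final with s₃ ≟ s
  ... | yes refl = s₂≢s₁ (injective (trans
          (trans (sym (cong (λ x → star x (f s₂)) fs≡0)) (mono (~-sym s₂~s₃))) c≡fs₁))
  ... | no  s₃≢s = ≢0 (λ s₁≡s → ~-irrefl (sym s₁≡s) s~s₁)
          (trans (sym c≡fs₁) (trans (sym (mono s₂~s₃)) (star-off (≢0 s₂≢s) (≢0 s₃≢s))))

-- The Gallai-Ramsey number

-- By Pascal's rule `k C 1` is a summand of `suc k C 2`.
k≤[1+k]C2 : ∀ k → k ≤ suc k C 2
k≤[1+k]C2 k = ℕ.≤-trans (ℕ.≤-reflexive (sym (nC1≡n k)))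
  (ℕ.≤-trans (m≤m+n (k C 1) (k C 2)) (ℕ.≤-reflexive (nCk+nC[k+1]≡[n+1]C[k+1] k 1)))

theorem2p3 : ∀ (k t : ℕ) → k ≥ 5 → k ≡ t →
    (H : Graph t) → NonEmpty H → ¬ Complete H → NoIsolatedVertex H →
    gr[ k ] P 5 ∶ H ≈ t + 1
theorem2p3 k@(suc m) _ 5≤k@(s≤s 4≤m) refl H _ ¬complete noIsolated =
  subst (gr[ k ] P 5 ∶ H ≈_) (ℕ.+-comm 1 k) ((k≤[1+k]C2 k , upper) , lower)
  where
  upper : ∀ n → suc k ≤ n → (χ : Coloring k n) → Exact χ →
          (∃ λ (copy : Copy (P 5) (K n)) → Rainbow χ copy) ⊎
          (∃ λ (copy : Copy H (K n)) → Monochromatic χ copy)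
  upper n k<n χ exact with rainbowPath? χ
  ... | inj₁ copy      = inj₁ copy
  ... | inj₂ noRainbow = inj₂ (forced 5≤k k<n H ¬complete χ exact noRainbow)

  lower : ∀ M → Forces k (P 5) H M → suc k ≤ M
  -- Any `M ≤ k` would force a copy in `K k` too, where the star colouring has none.
  lower M (_ , forces) = ℕ.≰⇒> λ M≤k →
    case (forces k M≤k (starColoring m) (star-exact (≤-trans (s≤s (s≤s z≤n)) 4≤m)))
    where
    case : (∃ λ (copy : Copy (P 5) (K k)) → Rainbow (starColoring m) copy) ⊎
           (∃ λ (copy : Copy H (K k)) → Monochromatic (starColoring m) copy) → ⊥
    case (inj₁ (copy , rainbow)) = star-noRainbow copy rainbow
    case (inj₂ (copy , mono))    =
      star-noMonochromatic (≤-trans (s≤s (s≤s (s≤s z≤n))) 4≤m) H noIsolated copy mono
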